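{- For every integer $n\ge 1$, $|\mathcal{S}_n(31;\,1\to 2)| = B_n$, where $B_n$ is the $n$-th Bell number.
   Context: $[n]=\{1,\dots,n\}$, and $\mathcal{S}_n$ is the set of permutations $\pi=\pi_1\pi_2\cdots\pi_n$ of $[n]$ in one-line notation. The permutation $\hat\pi$: for $\pi\in\mathcal{S}_n$, $\hat\pi\in\mathcal{S}_n$ is the permutation whose cycle form is obtained from the word $\pi_1\cdots\pi_n$ by inserting a left parenthesis before each left-to-right maximum (an entry larger than all entries to its left) and a right parenthesis immediately before the next left-to-right maximum, or at the end of the word. A cycle $(c_1,c_2,\dots,c_s)$ means $c_1\mapsto c_2\mapsto\cdots\mapsto c_s\mapsto c_1$. Example: if $\pi=2537164$ then $\hat\pi=(2)(53)(7164)$. Arrow patterns: an arrow pattern of size $k$ is a pair $(\nu;H)$ where $\nu=\nu_1\cdots\nu_m$ is a word of distinct positive integers, $H$ is a collection of arrows $b_i\to c_i$, and the set of all integers appearing in $\nu$ or $H$ is $[k]$. A permutation $\pi\in\mathcal{S}_n$ contains $(\nu;H)$ if there are a set $X=\{x_1<x_2<\cdots<x_k\}\subseteq[n]$ and indices $t_1<\cdots<t_m$ such that $\pi_{t_1}\pi_{t_2}\cdots\pi_{t_m}=x_{\nu_1}x_{\nu_2}\cdots x_{\nu_m}$ and $\hat\pi(x_{b_i})=x_{c_i}$ for every arrow $b_i\to c_i$ in $H$. Otherwise $\pi$ avoids $(\nu;H)$. $\mathcal{S}_n(\nu;H)$ is the set of permutations in $\mathcal{S}_n$ avoiding $(\nu;H)$.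 The Bell number $B_n$ is the number of set partitions of $[n]$. -}

module Defs where

open import Data.Bool.Properties using () renaming (_≟_ to _≟ᵇ_)
open import Data.Fin.Base using (Fin; zero; suc; _<_)
open import Data.Fin.Patterns using (0F; 1F; 2F)
open import Data.Fin.Properties using (_≟_; _<?_; any?)
open import Data.Fin.Subset using (Subset; inside; outside; Nonempty; Empty; _∩_; ⋃; ⊤)
open import Data.Fin.Subset.Properties using (nonempty?)
open import Data.List.Base
  using (List; []; _∷_; _++_; map; filter; foldr; length; allFin; cartesianProductWith)
open import Data.List.Relation.Unary.All as All using (All)
open import Data.List.Relation.Unary.AllPairs as AllPairs using (AllPairs)
open import Data.List.Relation.Unary.Any using (Any; here; there)
open import Data.Nat.Base using (ℕ; zero; suc)
open import Data.Product.Base using (∃; ∃₂; _×_; _,_; proj₁; proj₂)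
open import Data.Sum.Base using (_⊎_; inj₁; inj₂)
open import Data.Vec.Base as Vec using (Vec; []; _∷_; lookup; toList)
open import Data.Vec.Membership.Propositional using (_∈_)
import Data.Vec.Properties as Vec
import Data.Vec.Relation.Unary.All as VecAll
import Data.Vec.Relation.Unary.AllPairs as VecAllPairs
import Data.Vec.Relation.Unary.Any as VecAny
open import Data.Vec.Relation.Unary.Linked using (Linked; linked?)
open import Data.Vec.Relation.Unary.Unique.Propositional using (Unique; []; _∷_)
open import Function.Base using (_∘_; id)
open import Relation.Binary.PropositionalEquality.Core using (_≡_; refl)
open import Relation.Nullary.Decidable using (Dec; yes; no; map′; ¬?; _×-dec_)
open import Relation.Nullary.Negation using (¬_)
open import Relation.Unary using (Pred; Decidable)

private
  variable
    A : Set
    k m n : ℕ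

-- Throughout, Fin n plays the role of [n]: the integer i is the element i - 1.

-- All vectors of length m over a given list of letters.  If the letters are
-- distinct, each vector is listed exactly once.
vectors : List A → ∀ m → List (Vec A m)
vectors as zero    = [] ∷ []
vectors as (suc m) = cartesianProductWith _∷_ as (vectors as m)

-- All subsequences of a list.  If the entries of the list are distinct, these
-- are its sets of entries, each listed exactly once.
subsequences : List A → List (List A)
subsequences []       = [] ∷ []
subsequences (a ∷ as) = map (a ∷_) (subsequences as) ++ subsequences as

anyVec? : ∀ {m n p} {P : Pred (Vec (Fin n) m) p} → Decidable P → Dec (∃ P)
anyVec? {zero}  P? = map′ ([] ,_) (λ { ([] , p) → p }) (P? [])
anyVec? {suc m} P? =
  map′ (λ { (i , v , p) → (i ∷ v) , p })
       (λ { ((i ∷ v) , p) → i , v , p })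
       (any? λ i → anyVec? λ v → P? (i ∷ v))

unique? : Decidable (Unique {A = Fin n} {m})
unique? = VecAllPairs.allPairs? λ i j → ¬? (i ≟ j)

-- A permutation π in one-line notation is the word π₁ ⋯ πₙ with distinct
-- entries in Fin n.
Word : ℕ → Set
Word n = Vec (Fin n) n

𝒮 : ∀ n → List (Word n)
𝒮 n = filter unique? (vectors (allFin n) n)

-- Insertion of parentheses: a new cycle is opened at x exactly when x exceeds
-- every entry to its left.  The first argument holds those entries; the result
-- is the rest of the cycle currently open, followed by all later cycles.
parenthesise : List (Fin n) → List (Fin n) → List (Fin n) × List (List (Fin n))
parenthesise left []       = [] , []
parenthesise left (x ∷ xs) with All.all? (_<? x) left | parenthesise (x ∷ left) xs
... | yes _ | c , cs = [] , (x ∷ c) ∷ cs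
... | no _  | c , cs = x ∷ c , cs

-- The first entry of a word is always a left-to-right maximum, so the first
-- component discarded here is empty.
cycleForm : Word n → List (List (Fin n))
cycleForm π = proj₂ (parenthesise [] (toList π))

-- next c₁ cᵢ (cᵢ₊₁ ∷ ⋯ ∷ cₛ ∷ []) sends cᵢ ↦ cᵢ₊₁, …, cₛ₋₁ ↦ cₛ and cₛ ↦ c₁,
-- and fixes everything else.
next : Fin n → Fin n → List (Fin n) → Fin n → Fin n
next c₁ c []       x with x ≟ c
... | yes _ = c₁
... | no _  = x
next c₁ c (d ∷ cs) x with x ≟ c
... | yes _ = d
... | no _  = next c₁ d cs x

cycle : List (Fin n) → Fin n → Fin n
cycle []       = id
cycle (c ∷ cs) = next c c cs

-- π̂ is the product of its (disjoint) cycles.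
hat : Word n → Fin n → Fin n
hat π = foldr (λ c σ → cycle c ∘ σ) id (cycleForm π)

-- (b , c) ∈ arrows stands for the arrow b → c.
record ArrowPattern (k : ℕ) : Set where
  field
    {size}   : ℕ
    word     : Vec (Fin k) size
    arrows   : List (Fin k × Fin k)
    distinct : Unique word
    covers   : ∀ i → i ∈ word ⊎ Any (λ a → i ≡ proj₁ a ⊎ i ≡ proj₂ a) arrows

open ArrowPattern

Respects : Word n → Vec (Fin n) k → Fin k × Fin k → Set
Respects π x (b , c) = hat π (lookup x b) ≡ lookup x c

respects? : (π : Word n) (x : Vec (Fin n) k) → Decidable (Respects π x)
respects? π x (b , c) = hat π (lookup x b) ≟ lookup x c

-- x lists the elements x₁ < ⋯ < xₖ of X, and t the indices t₁ < ⋯ < tₘ.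
Occurrence : (τ : ArrowPattern k) → Word n → Vec (Fin n) k → Vec (Fin n) (size τ) → Set
Occurrence τ π x t =
  Linked _<_ x ×
  Linked _<_ t ×
  Vec.map (lookup π) t ≡ Vec.map (lookup x) (word τ) ×
  All (Respects π x) (arrows τ)

Contains : ArrowPattern k → Word n → Set
Contains τ π = ∃₂ λ x t → Occurrence τ π x t

Avoids : ArrowPattern k → Word n → Set
Avoids τ π = ¬ Contains τ π

avoids? : (τ : ArrowPattern k) → Decidable (Avoids {n = n} τ)
avoids? τ π = ¬? (anyVec? λ x → anyVec? λ t →
  linked? _<?_ x ×-dec
  linked? _<?_ t ×-dec
  Vec.≡-dec _≟_ (Vec.map (lookup π) t) (Vec.map (lookup x) (word τ)) ×-dec
  All.all? (respects? π x) (arrows τ))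

-- 𝒮ₙ(τ)
𝒮⟨_⟩ : ArrowPattern k → ∀ n → List (Word n)
𝒮⟨ τ ⟩ n = filter (avoids? τ) (𝒮 n)

-- The arrow pattern (31; 1 → 2), with entries shifted down by one.
⟨31∶1→2⟩ : ArrowPattern 3
⟨31∶1→2⟩ = record
  { word     = 2F ∷ 0F ∷ []
  ; arrows   = (0F , 1F) ∷ []
  ; distinct = ((λ ()) VecAll.∷ VecAll.[]) ∷ VecAll.[] ∷ []
  ; covers   = λ where
      0F → inj₁ (VecAny.there (VecAny.here refl))
      1F → inj₂ (here (inj₂ refl))
      2F → inj₁ (VecAny.here refl)
  }

subsets : ∀ n → List (Subset n)
subsets n = vectors (inside ∷ outside ∷ []) n

IsSetPartition : List (Subset n) → Set
IsSetPartition bs =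
  All Nonempty bs ×
  AllPairs (λ b c → Empty (b ∩ c)) bs ×
  ⋃ bs ≡ ⊤

isSetPartition? : Decidable (IsSetPartition {n})
isSetPartition? bs =
  All.all? nonempty? bs ×-dec
  AllPairs.allPairs? (λ b c → ¬? (nonempty? (b ∩ c))) bs ×-dec
  Vec.≡-dec _≟ᵇ_ (⋃ bs) ⊤

-- A set of blocks is represented by the subsequence of subsets n listing its
-- elements.
setPartitions : ∀ n → List (List (Subset n))
setPartitions n = filter isSetPartition? (subsequences (subsets n))

Bell : ℕ → ℕ
Bell n = length (setPartitions n)

{-# OPTIONS --safe #-}
module Submission where

-- If an entry a of π that is not last in its parenthesised block is followed
-- there by b > a, then the leader of the block, b and a form an occurrence of
-- (31; 1 → 2); and if every block is decreasing, the only ascent of π̂ inside a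
-- block goes from its last entry to its leader, which exceeds all entries before
-- it.  So π avoids the pattern iff every block of its cycle form is decreasing,
-- and such a cycle form is the same thing as a set partition of [n].
--
-- The subsets of [n] are listed in lexicographic order with inside first, which
-- sorts disjoint blocks by increasing minimum.  The blocks of a cycle form are
-- sorted by increasing maximum, so the bijection reflects [n] by i ↦ n + 1 - i
-- and reverses the list of blocks.

open import Defs
open import Data.Bool.Base using (true; false)
open import Data.Empty using (⊥)
open import Data.Fin.Base using (Fin; zero; suc; _<_; _≤_; _>_; opposite)
open import Data.Fin.Properties
  using ( _≟_; _<?_; ≤-refl; ≤-trans; ≤∧≢⇒<; <-trans; <⇒≢; <-irrefl; <-asym
        ; injective⇒≤; opposite-involutive; opposite-prop; toℕ<n)
open import Data.Fin.Subset using (Subset; inside; outside; Nonempty; Empty; _∩_; ⋃; ⊤)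
  renaming (_∈_ to _∈ₛ_)
open import Data.Fin.Subset.Properties
  using (_∈?_; x∈p∩q⁺; x∈p∩q⁻; x∈p∪q⁺; x∈p∪q⁻; ∉⊥; ∈⊤; ⊆-antisym)
open import Data.List.Base as List hiding (lookup; find)
open import Data.List.Properties
  using ( ++-identityʳ; length-tabulate; map-id-local; map-∘; map-injective
        ; unfold-reverse; reverse-map; reverse-involutive; reverse-injective)
open import Data.List.Membership.Propositional using (_∈_; _∉_; find)
import Data.List.Membership.DecPropositional as DecMembership
open import Data.List.Membership.Propositional.Properties
import Data.List.Membership.Setoid.Properties as SetoidMembership
open import Data.List.Relation.Unary.All as All using (All; []; _∷_)
import Data.List.Relation.Unary.All.Properties as All
open import Data.List.Relation.Unary.AllPairs as AllPairs using (AllPairs; []; _∷_)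
import Data.List.Relation.Unary.AllPairs.Properties as AllPairs
open import Data.List.Relation.Unary.Any as Any using (Any; here; there)
import Data.List.Relation.Unary.Any.Properties as Any
open import Data.List.Relation.Unary.Unique.Propositional using (Unique)
import Data.List.Relation.Unary.Unique.Propositional.Properties as Unique
open import Data.Nat.Base as ℕ using (ℕ; zero; suc; _≥_)
open import Data.Nat.Properties as ℕ using (<⇒≤; ≮⇒≥; <⇒≱; <-≤-trans; ∸-monoʳ-<; 1+n≰n)
open import Data.Product.Base using (∃; _×_; _,_; proj₁; proj₂)
open import Data.Sum.Base using (_⊎_; inj₁; inj₂; [_,_]′)
open import Data.Vec.Base as Vec using (Vec; []; _∷_; lookup; toList; here; there)
import Data.Vec.Properties as Vec
import Data.Vec.Relation.Unary.All as VecAll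
import Data.Vec.Relation.Unary.All.Properties as VecAll
import Data.Vec.Relation.Unary.AllPairs as VecAllPairs
open import Data.Vec.Relation.Unary.Linked using ([-]; _∷_)
open import Function.Base using (_∘_; flip; id)
open import Level using (0ℓ)
open import Relation.Binary.Core using (Rel)
open import Relation.Binary.Definitions using (Asymmetric)
open import Relation.Binary.PropositionalEquality
open import Relation.Nullary.Decidable using (Dec; yes; no; does; dec-true; decidable-stable)
open import Relation.Nullary.Negation using (¬_; contradiction)

private
  variable
    A B : Set
    n : ℕ

-- Counting by correspondences between lists.

lookup-injective : ∀ {xs : List A} → Unique xs → ∀ i j → List.lookup xs i ≡ List.lookup xs j → i ≡ j
lookup-injective {xs = x ∷ xs} u zero zero eq = refl
lookup-injective {xs = x ∷ xs} (x∉ ∷ u) zero (suc j) eq =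
  contradiction eq (All.lookup x∉ (∈-lookup j))
lookup-injective {xs = x ∷ xs} (x∉ ∷ u) (suc i) zero eq =
  contradiction (sym eq) (All.lookup x∉ (∈-lookup i))
lookup-injective {xs = x ∷ xs} (_ ∷ u) (suc i) (suc j) eq = cong suc (lookup-injective u i j eq)

-- Send each position of `xs` to the position in `ys` of a chosen partner. Equal images mean equal
-- partners, so left-uniqueness and `Unique xs` make this injective. With a relation in place of a
-- function, `flip R` yields the opposite inequality.
length-≤ : ∀ {xs : List A} {ys : List B} (R : A → B → Set) → Unique xs →
           (∀ {x} → x ∈ xs → ∃ λ y → y ∈ ys × R x y) →
           (∀ {x x′ y} → x ∈ xs → x′ ∈ xs → R x y → R x′ y → x ≡ x′) →
           length xs ℕ.≤ length ys
length-≤ {xs = xs} {ys} R xs! total left-unique = injective⇒≤ λ {i} {j} → f-injective i j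
  where
  image : ∀ i → ∃ λ y → y ∈ ys × R (List.lookup xs i) y
  image i = total (∈-lookup i)

  f : Fin (length xs) → Fin (length ys)
  f i = Any.index (proj₁ (proj₂ (image i)))

  f-injective : ∀ i j → f i ≡ f j → i ≡ j
  f-injective i j eq with image i | image j
  ... | y , y∈ , r | y′ , y′∈ , r′
    with refl ← SetoidMembership.index-injective (setoid _) y∈ y′∈ eq
    = lookup-injective xs! i j (left-unique (∈-lookup i) (∈-lookup j) r r′)

length-≡ : ∀ {xs : List A} {ys : List B} (R : A → B → Set) → Unique xs → Unique ys →
           (∀ {x} → x ∈ xs → ∃ λ y → y ∈ ys × R x y) →
           (∀ {y} → y ∈ ys → ∃ λ x → x ∈ xs × R x y) →
           (∀ {x x′ y} → x ∈ xs → x′ ∈ xs → R x y → R x′ y → x ≡ x′) →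
           (∀ {x y y′} → y ∈ ys → y′ ∈ ys → R x y → R x y′ → y ≡ y′) →
           length xs ≡ length ys
length-≡ R xs! ys! total surjective left-unique right-unique =
  ℕ.≤-antisym (length-≤ R xs! total left-unique) (length-≤ (flip R) ys! surjective right-unique)

-- Sorted lists and their subsequences.

map-AllPairs-∈ : ∀ {R S : Rel A 0ℓ} {xs} → (∀ {x y} → y ∈ xs → R x y → S x y) →
                 AllPairs R xs → AllPairs S xs
map-AllPairs-∈ f []       = []
map-AllPairs-∈ f (r ∷ rs) =
  All.tabulate (λ y∈ → f (there y∈) (All.lookup r y∈)) ∷ map-AllPairs-∈ (f ∘ there) rs

module _ {R : Rel A 0ℓ} where

  tabulate-AllPairs : ∀ xs → (∀ {x y} → x ∈ xs → y ∈ xs → R x y) → AllPairs R xs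
  tabulate-AllPairs []       r = []
  tabulate-AllPairs (x ∷ xs) r =
    All.tabulate (λ y∈ → r (here refl) (there y∈)) ∷
    tabulate-AllPairs xs (λ x∈ y∈ → r (there x∈) (there y∈))

  AllPairs-++⁻ : ∀ xs {ys} → AllPairs R (xs ++ ys) →
                 AllPairs R xs × AllPairs R ys × All (λ x → All (R x) ys) xs
  AllPairs-++⁻ []       rs = [] , rs , []
  AllPairs-++⁻ (x ∷ xs) (r ∷ rs) with AllPairs-++⁻ xs rs
  ... | rxs , rys , rxys = All.++⁻ˡ xs r ∷ rxs , rys , All.++⁻ʳ xs r ∷ rxys

  AllPairs-concat⁻ : ∀ xss → AllPairs R (concat xss) →
                     All (AllPairs R) xss × AllPairs (λ xs ys → All (λ x → All (R x) ys) xs) xss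
  AllPairs-concat⁻ []         rs = [] , []
  AllPairs-concat⁻ (xs ∷ xss) rs with AllPairs-++⁻ xs rs
  ... | rxs , ryss , rxyss with AllPairs-concat⁻ xss ryss
  ... | p , q =
    rxs ∷ p , All.tabulate (λ ys∈ → All.map (λ r → All.lookup (All.concat⁻ r) ys∈) rxyss) ∷ q

  AllPairs-reverse⁺ : ∀ {xs} → AllPairs (flip R) xs → AllPairs R (reverse xs)
  AllPairs-reverse⁺ [] = []
  AllPairs-reverse⁺ {x ∷ xs} (r ∷ rs) rewrite unfold-reverse x xs =
    AllPairs.++⁺ (AllPairs-reverse⁺ rs) ([] ∷ [])
      (All.tabulate λ y∈ → All.lookup r (Any.reverse⁻ y∈) ∷ [])

  module _ (asym : Asymmetric R) where

    -- Asymmetry makes R irreflexive, so x occurs only once in x ∷ xs.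
    AllPairs-unique : ∀ {xs ys} → AllPairs R xs → AllPairs R ys →
                      (∀ {z} → z ∈ xs → z ∈ ys) → (∀ {z} → z ∈ ys → z ∈ xs) → xs ≡ ys
    AllPairs-unique {[]}     {[]}     _        _        _   _   = refl
    AllPairs-unique {[]}     {y ∷ ys} _        _        _   ys⊆ with () ← ys⊆ (here refl)
    AllPairs-unique {x ∷ xs} {[]}     _        _        xs⊆ _   with () ← xs⊆ (here refl)
    AllPairs-unique {x ∷ xs} {y ∷ ys} (r ∷ rs) (s ∷ ss) xs⊆ ys⊆ = cong₂ _∷_ x≡y
      (AllPairs-unique rs ss
        (λ z∈ → strip (λ z≡y → irr (trans x≡y (sym z≡y)) (All.lookup r z∈)) (xs⊆ (there z∈)))
        (λ z∈ → strip (λ z≡x → irr (trans (sym x≡y) (sym z≡x)) (All.lookup s z∈)) (ys⊆ (there z∈))))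
      where
      irr : ∀ {a b} → a ≡ b → ¬ R a b
      irr refl raa = asym raa raa

      strip : ∀ {z w ws} → z ≢ w → z ∈ w ∷ ws → z ∈ ws
      strip z≢w (here z≡w) = contradiction z≡w z≢w
      strip z≢w (there z∈) = z∈

      x≡y : x ≡ y
      x≡y with xs⊆ (here refl) | ys⊆ (here refl)
      ... | here eq  | _        = eq
      ... | there _  | here eq  = sym eq
      ... | there x∈ | there y∈ = contradiction (All.lookup s x∈) (asym (All.lookup r y∈))

    -- As both lists are sorted by the same asymmetric relation, greedy matching works: keep `x` if
    -- it heads `ys`, and drop it otherwise.
    ∈-subsequences⁺ : ∀ {xs ys} → AllPairs R xs → AllPairs R ys →
                      (∀ {z} → z ∈ ys → z ∈ xs) → ys ∈ subsequences xs
    ∈-subsequences⁺ {[]}     {[]}     _  _  _   = here refl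
    ∈-subsequences⁺ {[]}     {y ∷ ys} _  _  ys⊆ with () ← ys⊆ (here refl)
    ∈-subsequences⁺ {x ∷ xs} {[]}     (_ ∷ rs) _  _   =
      ∈-++⁺ʳ (map (x ∷_) (subsequences xs)) (∈-subsequences⁺ rs [] λ ())
    ∈-subsequences⁺ {x ∷ xs} {y ∷ ys} (r ∷ rs) (s ∷ ss) ys⊆ with ys⊆ (here refl)
    ... | here refl = ∈-++⁺ˡ (∈-map⁺ (x ∷_) (∈-subsequences⁺ rs ss ys⊆xs))
      where
      ys⊆xs : ∀ {z} → z ∈ ys → z ∈ xs
      ys⊆xs z∈ with ys⊆ (there z∈)
      ... | here refl = contradiction (All.lookup s z∈) (asym (All.lookup s z∈))
      ... | there z∈xs = z∈xs
    ... | there y∈xs = ∈-++⁺ʳ (map (x ∷_) (subsequences xs)) (∈-subsequences⁺ rs (s ∷ ss) y∷ys⊆xs)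
      where
      -- `x` is not a later entry of `ys` either: it comes before `y` in the first list and would
      -- come after `y` in the second.
      y∷ys⊆xs : ∀ {z} → z ∈ y ∷ ys → z ∈ xs
      y∷ys⊆xs (here refl) = y∈xs
      y∷ys⊆xs (there z∈) with ys⊆ (there z∈)
      ... | here refl = contradiction (All.lookup s z∈) (asym (All.lookup r y∈xs))
      ... | there z∈xs = z∈xs

∈-subsequences⁻ : ∀ (xs : List A) {ys} → ys ∈ subsequences xs → ∀ {z} → z ∈ ys → z ∈ xs
∈-subsequences⁻ []       (here refl) ()
∈-subsequences⁻ (x ∷ xs) ys∈ z∈ with ∈-++⁻ (map (x ∷_) (subsequences xs)) ys∈
... | inj₂ ys∈′ = there (∈-subsequences⁻ xs ys∈′ z∈)
... | inj₁ ys∈′ with ∈-map⁻ (x ∷_) ys∈′ | z∈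
...   | _ , zs∈ , refl | here z≡x = here z≡x
...   | _ , zs∈ , refl | there z∈ = there (∈-subsequences⁻ xs zs∈ z∈)

AllPairs-subsequences : ∀ {R : Rel A 0ℓ} {xs ys} →
                        AllPairs R xs → ys ∈ subsequences xs → AllPairs R ys
AllPairs-subsequences [] (here refl) = []
AllPairs-subsequences {xs = x ∷ xs} (r ∷ rs) ys∈ with ∈-++⁻ (map (x ∷_) (subsequences xs)) ys∈
... | inj₂ ys∈′ = AllPairs-subsequences rs ys∈′
... | inj₁ ys∈′ with ∈-map⁻ (x ∷_) ys∈′
...   | _ , zs∈ , refl =
  All.tabulate (λ z∈ → All.lookup r (∈-subsequences⁻ xs zs∈ z∈)) ∷ AllPairs-subsequences rs zs∈

subsequences-unique : ∀ {xs : List A} → Unique xs → Unique (subsequences xs)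
subsequences-unique [] = [] ∷ []
subsequences-unique {xs = x ∷ xs} (x∉ ∷ xs!) =
  Unique.++⁺ (Unique.map⁺ (λ { refl → refl }) ih) ih λ (p , q) → disjoint (∈-map⁻ (x ∷_) p) q
  where
  ih = subsequences-unique xs!
  disjoint : ∀ {ys} → (∃ λ zs → zs ∈ subsequences xs × ys ≡ x ∷ zs) → ¬ ys ∈ subsequences xs
  disjoint (_ , _ , refl) q = contradiction refl (All.lookup x∉ (∈-subsequences⁻ xs q (here refl)))

-- The pattern as a condition on pairs of entries.

module _ {R : Rel A 0ℓ} where

  toList-AllPairs⁺ : ∀ {v : Vec A n} → VecAllPairs.AllPairs R v → AllPairs R (toList v)
  toList-AllPairs⁺ VecAllPairs.[]       = []
  toList-AllPairs⁺ (r VecAllPairs.∷ rs) = VecAll.toList⁺ r ∷ toList-AllPairs⁺ rs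

  toList-AllPairs⁻ : ∀ {v : Vec A n} → AllPairs R (toList v) → VecAllPairs.AllPairs R v
  toList-AllPairs⁻ {v = []}    []       = VecAllPairs.[]
  toList-AllPairs⁻ {v = _ ∷ _} (r ∷ rs) = VecAll.toList⁻ r VecAllPairs.∷ toList-AllPairs⁻ rs

  AllPairs-lookup⁺ : ∀ (v : Vec A n) → (∀ {i j} → i < j → R (lookup v i) (lookup v j)) →
                     VecAllPairs.AllPairs R v
  AllPairs-lookup⁺ []      r = VecAllPairs.[]
  AllPairs-lookup⁺ (x ∷ v) r =
    VecAll.lookup⁻ (λ j → r {zero} {suc j} ℕ.z<s) VecAllPairs.∷ AllPairs-lookup⁺ v (r ∘ ℕ.s<s)

  AllPairs-lookup⁻ : ∀ {v : Vec A n} → VecAllPairs.AllPairs R v →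
                     ∀ {i j} → i < j → R (lookup v i) (lookup v j)
  AllPairs-lookup⁻ (r VecAllPairs.∷ _)  {zero}  {suc j} _         = VecAll.lookup⁺ r j
  AllPairs-lookup⁻ (_ VecAllPairs.∷ rs) {suc i} {suc j} (ℕ.s<s i<j) = AllPairs-lookup⁻ rs i<j

-- `u` plays the letter 3 and the later entry `v` the letter 1; the letter 2 is then forced to be
-- `h v`. Taking any map and list allows splitting along the blocks of a concatenation.
_AvoidsArrow_ : (Fin n → Fin n) → List (Fin n) → Set
h AvoidsArrow xs = AllPairs (λ u v → ¬ (v < h v × h v < u)) xs

avoids⇒avoidsArrow : (π : Word n) → Avoids ⟨31∶1→2⟩ π → hat π AvoidsArrow toList π
avoids⇒avoidsArrow π avoids = toList-AllPairs⁺ (AllPairs-lookup⁺ π λ {i} {j} i<j (v<hv , hv<u) →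
  avoids (lookup π j ∷ hat π (lookup π j) ∷ lookup π i ∷ [] , i ∷ j ∷ [] ,
          v<hv ∷ hv<u ∷ [-] , i<j ∷ [-] , refl , refl ∷ []))

avoidsArrow⇒avoids : (π : Word n) → hat π AvoidsArrow toList π → Avoids ⟨31∶1→2⟩ π
avoidsArrow⇒avoids π avoids (x₁ ∷ x₂ ∷ x₃ ∷ [] , i ∷ j ∷ [] ,
                             x₁<x₂ ∷ x₂<x₃ ∷ [-] , i<j ∷ [-] , refl , refl ∷ []) =
  AllPairs-lookup⁻ (toList-AllPairs⁻ avoids) i<j (x₁<x₂ , x₂<x₃)

-- Blocks produced by inserting parentheses.

Descending : List (Fin n) → Set
Descending = AllPairs _>_

-- The value `⊥` at `[]` makes blocks nonempty, so that each has a leader.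
HeadMax : List (Fin n) → Set
HeadMax []       = ⊥
HeadMax (x ∷ xs) = All (_≤ x) xs

-- For a decreasing d this compares maxima.  As [] ≺ d says that d is nonempty,
-- AllPairs _≺_ ([] ∷ cs) makes the blocks cs nonempty and sorts them by maximum.
infix 4 _≺_

_≺_ : List (Fin n) → List (Fin n) → Set
c ≺ d = Any (λ y → All (_< y) c) d

≺-antimono : ∀ {c c′ d : List (Fin n)} → (∀ {x} → x ∈ c′ → x ∈ c) → c ≺ d → c′ ≺ d
≺-antimono c′⊆c = Any.map (λ c< → All.tabulate (All.lookup c< ∘ c′⊆c))

headMax-≤ : ∀ {c} {x : Fin n} → HeadMax (x ∷ c) → ∀ {y} → y ∈ x ∷ c → y ≤ x
headMax-≤ _  (here refl) = ≤-refl
headMax-≤ c≤ (there y∈)  = All.lookup c≤ y∈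

descending⇒headMax : ∀ {c} {x : Fin n} → Descending (x ∷ c) → HeadMax (x ∷ c)
descending⇒headMax (c< ∷ _) = All.map <⇒≤ c<

≺-head : ∀ {c d} {x : Fin n} → HeadMax (x ∷ d) → c ≺ x ∷ d → All (_< x) c
≺-head d≤ (here c<)  = c<
≺-head d≤ (there c≺d) =
  All.lookupWith (λ y≤x c<y → All.map (λ z<y → <-≤-trans z<y y≤x) c<y) d≤ c≺d

concat-parenthesise : ∀ (left xs : List (Fin n)) →
  proj₁ (parenthesise left xs) ++ concat (proj₂ (parenthesise left xs)) ≡ xs
concat-parenthesise left []       = refl
concat-parenthesise left (x ∷ xs)
  with All.all? (_<? x) left | parenthesise (x ∷ left) xs | concat-parenthesise (x ∷ left) xs
... | yes _ | c , cs | eq = cong (x ∷_) eq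
... | no _  | c , cs | eq = cong (x ∷_) eq

-- For the induction, everything before the next opening, that is `left` and the rest of the open
-- cycle, is gathered into one first block. Each later leader exceeds all entries to its left, hence
-- all of that block.
parenthesise-≺ : ∀ (left xs : List (Fin n)) →
  AllPairs _≺_ ((proj₁ (parenthesise left xs) ++ left) ∷ proj₂ (parenthesise left xs))
parenthesise-≺ left []       = [] ∷ []
parenthesise-≺ left (x ∷ xs)
  with All.all? (_<? x) left | parenthesise (x ∷ left) xs | parenthesise-≺ (x ∷ left) xs
... | yes left<x | c , cs | c≺ ∷ ≺s =
  (here left<x ∷ All.map (≺-antimono (∈-++⁺ʳ c ∘ there)) c≺) ∷
  All.map (≺-antimono (λ { (here refl) → ∈-++⁺ʳ c (here refl) ; (there y∈) → ∈-++⁺ˡ y∈ })) c≺ ∷ ≺s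
... | no _       | c , cs | c≺ ∷ ≺s = All.map (≺-antimono swap) c≺ ∷ ≺s
  where
  swap : ∀ {y} → y ∈ x ∷ c ++ left → y ∈ c ++ x ∷ left
  swap (here refl) = ∈-++⁺ʳ c (here refl)
  swap (there y∈) with ∈-++⁻ c y∈
  ... | inj₁ y∈c = ∈-++⁺ˡ y∈c
  ... | inj₂ y∈l = ∈-++⁺ʳ c (there y∈l)

-- An entry that opens no cycle is at most some entry to its left. Once `x` opens a cycle by
-- exceeding all of `left`, every bound found in `x ∷ left` turns into the bound `x`.
parenthesise-headMax : ∀ (left xs : List (Fin n)) →
  All (λ y → Any (y ≤_) left) (proj₁ (parenthesise left xs)) ×
  All HeadMax (proj₂ (parenthesise left xs))
parenthesise-headMax left []       = [] , []
parenthesise-headMax left (x ∷ xs)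
  with All.all? (_<? x) left | parenthesise (x ∷ left) xs | parenthesise-headMax (x ∷ left) xs
... | yes left<x | c , cs | c≤ , maxs = [] , All.map below c≤ ∷ maxs
  where
  below : ∀ {y} → Any (y ≤_) (x ∷ left) → y ≤ x
  below (here y≤x) = y≤x
  below (there y≤) = All.lookupWith (λ l<x y≤l → ≤-trans y≤l (<⇒≤ l<x)) left<x y≤
... | no left≮x  | c , cs | c≤ , maxs = x≤ ∷ All.map through c≤ , maxs
  where
  x≤ : Any (x ≤_) left
  x≤ = Any.map ≮⇒≥ (All.¬All⇒Any¬ (_<? x) left left≮x)
  through : ∀ {y} → Any (y ≤_) (x ∷ left) → Any (y ≤_) left
  through (here y≤x) = Any.map (≤-trans y≤x) x≤
  through (there y≤) = y≤

-- Every entry of `c` has an upper bound to its left, so none opens a cycle. `c ʳ++ left` is the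
-- accumulator after reading `c`, latest entry first.
parenthesise-++ : ∀ (left c rest : List (Fin n)) → All (λ y → Any (y ≤_) left) c →
  let d , ds = parenthesise (c ʳ++ left) rest in parenthesise left (c ++ rest) ≡ (c ++ d , ds)
parenthesise-++ left []      rest []       = refl
parenthesise-++ left (x ∷ c) rest (x≤ ∷ c≤)
  with All.all? (_<? x) left | parenthesise (x ∷ left) (c ++ rest)
     | parenthesise-++ (x ∷ left) c rest (All.map there c≤)
... | yes left<x | _ | _    = contradiction x≤ (All.All¬⇒¬Any (All.map <⇒≱ left<x))
... | no _       | _ | refl = refl

-- The head of each block exceeds everything before it and opens a cycle; the rest of the block lies
-- below the head and joins it by `parenthesise-++`. Placing `left` in front of the chain carries
-- this through the induction.
parenthesise-concat : ∀ (left : List (Fin n)) {cs} →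
  All Descending cs → AllPairs _≺_ (left ∷ cs) →
  parenthesise left (concat cs) ≡ ([] , cs)
parenthesise-concat left []       _ = refl
parenthesise-concat left {[] ∷ cs} _ ((() ∷ _) ∷ _)
parenthesise-concat left {(x ∷ c) ∷ cs} ((c<x ∷ _) ∷ descs) ((left≺c ∷ left≺) ∷ c≺ ∷ ≺s)
  with All.all? (_<? x) left | parenthesise (x ∷ left) (c ++ concat cs)
     | parenthesise-++ (x ∷ left) c (concat cs) (All.map (here ∘ <⇒≤) c<x)
     | parenthesise-concat (c ʳ++ x ∷ left) descs (All.tabulate left′≺ ∷ ≺s)
  where
  -- The new accumulator consists of `left` and the block `x ∷ c`; the head `z` of a later block
  -- exceeds every entry of both.
  left′≺ : ∀ {d} → d ∈ cs → c ʳ++ x ∷ left ≺ d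
  left′≺ {[]}    d∈ with () ← All.lookup left≺ d∈
  left′≺ {z ∷ d} d∈ = here (All.tabulate λ y∈ →
    [ All.lookup left<z , All.lookup c<z ]′ (Any.reverseAcc⁻ left (x ∷ c) y∈))
    where
    zMax = descending⇒headMax (All.lookup descs d∈)
    c<z = ≺-head zMax (All.lookup c≺ d∈)
    left<z = ≺-head zMax (All.lookup left≺ d∈)
... | no left≮x | _ | _    | _  = contradiction (≺-head (All.map <⇒≤ c<x) left≺c) left≮x
... | yes _     | _ | refl | eq rewrite eq | ++-identityʳ c = refl

-- Products of disjoint cycles.

-- `hat π` is `cycles (cycleForm π)` by definition.
cycles : List (List (Fin n)) → Fin n → Fin n
cycles = foldr (λ c σ → cycle c ∘ σ) id

next-∉ : ∀ p c cs {x : Fin n} → x ∉ c ∷ cs → next p c cs x ≡ x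
next-∉ p c []       {x} x∉ with x ≟ c
... | yes refl = contradiction (here refl) x∉
... | no _     = refl
next-∉ p c (d ∷ cs) {x} x∉ with x ≟ c
... | yes refl = contradiction (here refl) x∉
... | no _     = next-∉ p d cs (x∉ ∘ there)

cycle-∉ : ∀ c {x : Fin n} → x ∉ c → cycle c x ≡ x
cycle-∉ []       _  = refl
cycle-∉ (c ∷ cs) x∉ = next-∉ c c cs x∉

-- The image is a successor, hence in `cs`, or else `p`. Taking `p` to be `c` shows that a cycle
-- preserves its support.
next-∈ : ∀ p c cs {x : Fin n} → x ∈ c ∷ cs → next p c cs x ∈ p ∷ cs
next-∈ p c []       {x} x∈ with x ≟ c
... | yes _  = here refl
... | no x≢c with here x≡c ← x∈ = contradiction x≡c x≢c
next-∈ p c (d ∷ cs) {x} x∈ with x ≟ c | x∈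
... | yes _  | _         = there (here refl)
... | no x≢c | here x≡c  = contradiction x≡c x≢c
... | no x≢c | there x∈′ with next-∈ p d cs x∈′
...   | here eq   = here eq
...   | there y∈ = there (there y∈)

cycle-∈ : ∀ c {x : Fin n} → x ∈ c → cycle c x ∈ c
cycle-∈ (c ∷ cs) x∈ = next-∈ c c cs x∈

Disjoint : List A → List A → Set
Disjoint xs ys = All (λ x → All (x ≢_) ys) xs

cycles-∉ : ∀ cs {x : Fin n} → All (x ∉_) cs → cycles cs x ≡ x
cycles-∉ []       []         = refl
cycles-∉ (c ∷ cs) (x∉ ∷ x∉s) = trans (cong (cycle c) (cycles-∉ cs x∉s)) (cycle-∉ c x∉)

-- The cycles applied before `c` fix `x`; those applied after it fix `cycle c x`, which still lies
-- in `c`.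
cycles-∈ : ∀ {cs c} {x : Fin n} → AllPairs Disjoint cs → c ∈ cs → x ∈ c → cycles cs x ≡ cycle c x
cycles-∈ {cs = c ∷ cs} (d ∷ ds) (here refl) x∈ = cong (cycle c) (cycles-∉ cs
  (All.map (λ x≢ x∈d → All.lookup (All.lookup x≢ x∈) x∈d refl) d))
cycles-∈ {cs = c ∷ cs} (d ∷ ds) (there {xs = cs} c′∈) x∈ =
  trans (cong (cycle c) (cycles-∈ ds c′∈ x∈))
    (cycle-∉ c λ y∈c → All.lookup (All.lookup (All.lookup d c′∈) y∈c) (cycle-∈ _ x∈) refl)

-- Avoidance and decreasing blocks.

-- Every step goes down except the one from the last entry to `p`; an `x` outside the list is fixed.
next-descending : ∀ p c cs (x : Fin n) →
                  Descending (c ∷ cs) → next p c cs x ≤ x ⊎ next p c cs x ≡ p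
next-descending p c []       x _ with x ≟ c
... | yes _ = inj₂ refl
... | no _  = inj₁ ≤-refl
next-descending p c (d ∷ cs) x ((d<c ∷ _) ∷ desc) with x ≟ c
... | yes refl = inj₁ (<⇒≤ d<c)
... | no _     = next-descending p d cs x desc

cycle-descending : ∀ {c} {x : Fin n} → Descending c → x ∈ c →
                   cycle c x ≤ x ⊎ All (_≤ cycle c x) c
cycle-descending {c = c ∷ cs} {x} desc x∈ with next-descending c c cs x desc
... | inj₁ ≤x = inj₁ ≤x
... | inj₂ eq rewrite eq = inj₂ (≤-refl ∷ descending⇒headMax desc)

descending⇒avoidsArrow : ∀ {cs : List (List (Fin n))} → AllPairs _≺_ cs → AllPairs Disjoint cs →
                         All Descending cs → cycles cs AvoidsArrow concat cs
descending⇒avoidsArrow {cs = cs} prec disj descs = AllPairs.concat⁺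
  (All.tabulate λ {c} c∈ → tabulate-AllPairs c λ u∈ v∈ →
    avoid c∈ v∈ (Any.map (λ { refl → ≤-refl }) u∈))
  (map-AllPairs-∈ (λ d∈ c≺d → All.tabulate λ u∈ → All.tabulate λ v∈ →
    avoid d∈ v∈ (Any.map (λ c<y → <⇒≤ (All.lookup c<y u∈)) c≺d)) prec)
  where
  -- `Any (u ≤_) d` covers `u` in the block of `v` as well as `u` in an earlier block, through the
  -- witness of `c ≺ d`. An ascent at `v` lands on the maximum of `d`, which is at least `u`.
  avoid : ∀ {d u v} → d ∈ cs → v ∈ d → Any (u ≤_) d → ¬ (v < cycles cs v × cycles cs v < u)
  avoid d∈ v∈ u≤ (v<hv , hv<u) rewrite cycles-∈ disj d∈ v∈
    with cycle-descending (All.lookup descs d∈) v∈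
  ... | inj₁ hv≤v = <⇒≱ v<hv hv≤v
  ... | inj₂ d≤hv = <⇒≱ hv<u (All.lookupWith (λ y≤ u≤y → ≤-trans u≤y y≤) d≤hv u≤)

-- `m` stays the leader of the block while the list shrinks to its tails. An ascent from `c` to its
-- successor `d` would give `c < d < m`, which the last hypothesis forbids.
next⇒descending : ∀ (p c : Fin n) cs {m : Fin n} → Unique (c ∷ cs) → All (_< m) cs →
                  (∀ {v} → v ∈ c ∷ cs → ¬ (v < next p c cs v × next p c cs v < m)) →
                  Descending (c ∷ cs)
next⇒descending p c []       _ _ _ = [] ∷ []
next⇒descending p c (d ∷ cs) {m} ((c≢d ∷ c∉) ∷ u) (d<m ∷ cs<m) avoid =
  (d<c ∷ All.map (λ e<d → <-trans e<d d<c) (AllPairs.head desc)) ∷ desc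
  where
  at-c : next p c (d ∷ cs) c ≡ d
  at-c with c ≟ c
  ... | yes _  = refl
  ... | no c≢c = contradiction refl c≢c

  d<c : d < c
  d<c = ≤∧≢⇒<
    (≮⇒≥ λ c<d → avoid (here refl) (subst (c <_) (sym at-c) c<d , subst (_< m) (sym at-c) d<m))
    (c≢d ∘ sym)

  -- `c` does not recur, so removing it from the front changes no other image.
  past-c : ∀ {v} → v ∈ d ∷ cs → next p c (d ∷ cs) v ≡ next p d cs v
  past-c {v} v∈ with v ≟ c
  ... | yes refl = contradiction refl (All.lookup (c≢d ∷ c∉) v∈)
  ... | no _     = refl

  desc : Descending (d ∷ cs)
  desc = next⇒descending p d cs u cs<m λ {v} v∈ →
    subst (λ w → ¬ (v < w × w < m)) (past-c v∈) (avoid (there v∈))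

avoidsArrow⇒descending : ∀ {cs : List (List (Fin n))} → All HeadMax cs → Unique (concat cs) →
                         cycles cs AvoidsArrow concat cs → All Descending cs
avoidsArrow⇒descending {cs = cs} maxs u avoid
  with AllPairs-concat⁻ cs u | AllPairs-concat⁻ cs avoid
... | us , disj | avoids , _ = All.tabulate λ c∈ →
  block (All.lookup maxs c∈) (All.lookup us c∈) (All.lookup avoids c∈) (cycles-∈ disj c∈)
  where
  block : ∀ {c} → HeadMax c → Unique c → cycles cs AvoidsArrow c →
          (∀ {x} → x ∈ c → cycles cs x ≡ cycle c x) → Descending c
  block {c ∷ c′} c≤ (c≢ ∷ u) (av ∷ _) eq = next⇒descending c c c′ (c≢ ∷ u) c<c′s avoid′
    where
    c<c′s : All (_< c) c′
    c<c′s = All.zipWith (λ (x≤c , c≢x) → ≤∧≢⇒< x≤c (c≢x ∘ sym)) (c≤ , c≢)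

    -- `av` pairs the leader `c` with each later entry of its block. At the leader itself the two
    -- inequalities would give `c < c`.
    avoid′ : ∀ {v} → v ∈ c ∷ c′ → ¬ (v < cycle (c ∷ c′) v × cycle (c ∷ c′) v < c)
    avoid′ (here refl) (c<hc , hc<c) = <-irrefl refl (<-trans c<hc hc<c)
    avoid′ (there v∈)  = subst (λ w → ¬ (_ < w × w < c)) (eq (there v∈)) (All.lookup av v∈)

-- Vectors, and the lexicographic order on subsets.

∈-vectors : ∀ {as : List A} → (∀ a → a ∈ as) → ∀ {m} (v : Vec A m) → v ∈ vectors as m
∈-vectors ∈as []      = here refl
∈-vectors ∈as (a ∷ v) = ∈-cartesianProductWith⁺ _∷_ (∈as a) (∈-vectors ∈as v)

vectors-unique : ∀ {as : List A} → Unique as → ∀ m → Unique (vectors as m)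
vectors-unique as! zero    = [] ∷ []
vectors-unique as! (suc m) =
  Unique.cartesianProductWith⁺ _∷_ Vec.∷-injective as! (vectors-unique as! m)

infix 4 _⊏_

-- `this` sits at the first coordinate where the two subsets differ.
data _⊏_ : Subset n → Subset n → Set where
  this : {p q : Subset n} → inside ∷ p ⊏ outside ∷ q
  skip : ∀ {s} {p q : Subset n} → p ⊏ q → s ∷ p ⊏ s ∷ q

⊏-asym : Asymmetric (_⊏_ {n})
⊏-asym (skip p⊏q) (skip q⊏p) = ⊏-asym p⊏q q⊏p

subsets-⊏ : ∀ n → AllPairs _⊏_ (subsets n)
subsets-⊏ zero    = [] ∷ []
-- `cartesianProductWith` unfolds to the `inside` half, the `outside` half and a final `[]`.
subsets-⊏ (suc n) = AllPairs.++⁺ with-0 (AllPairs.++⁺ with-0 [] (All.tabulate λ _ → []))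
  (All.map⁺ (All.tabulate λ _ → All.++⁺ (All.map⁺ (All.tabulate λ _ → this)) []))
  where
  with-0 : ∀ {s} → AllPairs _⊏_ (map (s ∷_) (subsets n))
  with-0 = AllPairs.map⁺ (AllPairs.map skip (subsets-⊏ n))

∈-subsets : (p : Subset n) → p ∈ subsets n
∈-subsets = ∈-vectors λ { true → here refl ; false → there (here refl) }

subsets-unique : ∀ n → Unique (subsets n)
subsets-unique = vectors-unique (((λ ()) ∷ []) ∷ [] ∷ [])

-- Before the minimum of `p` both subsets have only `outside`; at that minimum, which is at most
-- `i`, only `p` has `inside`.
min<⇒⊏ : ∀ {i} {p q : Subset n} → i ∈ₛ p → (∀ {j} → j ∈ₛ q → i < j) → p ⊏ q
min<⇒⊏ {q = inside  ∷ q} i∈p         i<q with () ← i<q here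
min<⇒⊏ {q = outside ∷ q} here        i<q = this
min<⇒⊏ {p = inside  ∷ p} {outside ∷ q} (there i∈p) i<q = this
min<⇒⊏ {p = outside ∷ p} {outside ∷ q} (there i∈p) i<q =
  skip (min<⇒⊏ i∈p (ℕ.s<s⁻¹ ∘ i<q ∘ there))

-- Disjointness excludes a common `inside` before the first difference, so both subsets are empty up
-- to there, and that position is the minimum of `p`.
⊏⇒min< : ∀ {p q : Subset n} → Empty (p ∩ q) → p ⊏ q →
         ∃ λ i → i ∈ₛ p × (∀ {j} → j ∈ₛ q → i < j)
⊏⇒min< disj this = zero , here , λ { (there _) → ℕ.z<s }
⊏⇒min< disj (skip {s = inside}  p⊏q) = contradiction (zero , here) disj
⊏⇒min< disj (skip {s = outside} p⊏q) with ⊏⇒min< (λ (i , i∈) → disj (suc i , there i∈)) p⊏q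
... | i , i∈p , i<q = suc i , there i∈p , λ { (there j∈q) → ℕ.s<s (i<q j∈q) }

∈-⋃⁺ : ∀ {i} {ps : List (Subset n)} → Any (i ∈ₛ_) ps → i ∈ₛ ⋃ ps
∈-⋃⁺ (here i∈)  = x∈p∪q⁺ (inj₁ i∈)
∈-⋃⁺ (there i∈) = x∈p∪q⁺ (inj₂ (∈-⋃⁺ i∈))

∈-⋃⁻ : ∀ {i} (ps : List (Subset n)) → i ∈ₛ ⋃ ps → Any (i ∈ₛ_) ps
∈-⋃⁻ []       i∈ = contradiction i∈ ∉⊥
∈-⋃⁻ (p ∷ ps) i∈ with x∈p∪q⁻ p (⋃ ps) i∈
... | inj₁ i∈p = here i∈p
... | inj₂ i∈ps = there (∈-⋃⁻ ps i∈ps)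

-- Reflection, and subsets as descending lists.

opposite-< : ∀ {i j : Fin n} → i < j → opposite j < opposite i
opposite-< {n} {i} {j} i<j rewrite opposite-prop i | opposite-prop j =
  ∸-monoʳ-< (ℕ.s<s i<j) (toℕ<n j)

opposite-<-swapˡ : ∀ {i j : Fin n} → i < opposite j → j < opposite i
opposite-<-swapˡ {i = i} {j} i< = subst (_< opposite i) (opposite-involutive j) (opposite-< i<)

opposite-<-swapʳ : ∀ {i j : Fin n} → opposite i < j → opposite j < i
opposite-<-swapʳ {i = i} {j} <j = subst (opposite j <_) (opposite-involutive i) (opposite-< <j)

_∈ₗ?_ : ∀ (i : Fin n) is → Dec (i ∈ is)
_∈ₗ?_ = DecMembership._∈?_ _≟_

-- `tabulate opposite` runs downwards through all of `Fin n`, so filtering it lists the reflected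
-- subset in descending order.
fromSubset : Subset n → List (Fin n)
fromSubset p = filter (λ i → opposite i ∈? p) (tabulate opposite)

toSubset : List (Fin n) → Subset n
toSubset c = Vec.tabulate λ i → does (opposite i ∈ₗ? c)

∈-fromSubset⁺ : ∀ {p : Subset n} {i} → opposite i ∈ₛ p → i ∈ fromSubset p
∈-fromSubset⁺ {p = p} {i} i∈ = ∈-filter⁺ (λ i → opposite i ∈? p)
  (subst (_∈ tabulate opposite) (opposite-involutive i) (∈-tabulate⁺ (opposite i))) i∈

∈-fromSubset⁻ : ∀ {p : Subset n} {i} → i ∈ fromSubset p → opposite i ∈ₛ p
∈-fromSubset⁻ {p = p} i∈ =
  proj₂ (∈-filter⁻ (λ i → opposite i ∈? p) {xs = tabulate opposite} i∈)

∈-toSubset⁺ : ∀ {c} {i : Fin n} → opposite i ∈ c → i ∈ₛ toSubset c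
∈-toSubset⁺ {c = c} {i} i∈ = Vec.lookup⇒[]= i (toSubset c)
  (trans (Vec.lookup∘tabulate _ i) (dec-true (opposite i ∈ₗ? c) i∈))

∈-toSubset⁻ : ∀ {c} {i : Fin n} → i ∈ₛ toSubset c → opposite i ∈ c
∈-toSubset⁻ {c = c} {i} i∈
  with opposite i ∈ₗ? c | trans (sym (Vec.lookup∘tabulate _ i)) (Vec.[]=⇒lookup i∈)
... | yes p | _ = p

∈-fromSubset⁺′ : ∀ {p : Subset n} {i} → i ∈ₛ p → opposite i ∈ fromSubset p
∈-fromSubset⁺′ {p = p} {i} i∈ = ∈-fromSubset⁺ (subst (_∈ₛ p) (sym (opposite-involutive i)) i∈)

∈-toSubset⁺′ : ∀ {c} {i : Fin n} → i ∈ c → opposite i ∈ₛ toSubset c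
∈-toSubset⁺′ {c = c} {i} i∈ = ∈-toSubset⁺ (subst (_∈ c) (sym (opposite-involutive i)) i∈)

fromSubset-injective : ∀ {p q : Subset n} → fromSubset p ≡ fromSubset q → p ≡ q
fromSubset-injective eq = ⊆-antisym (half eq) (half (sym eq))
  where
  half : ∀ {p q : Subset _} → fromSubset p ≡ fromSubset q → ∀ {i} → i ∈ₛ p → i ∈ₛ q
  half {q = q} eq {i} i∈ = subst (_∈ₛ q) (opposite-involutive i)
    (∈-fromSubset⁻ (subst (opposite i ∈_) eq (∈-fromSubset⁺′ i∈)))

fromSubset-descending : (p : Subset n) → Descending (fromSubset p)
fromSubset-descending p =
  AllPairs.filter⁺ (λ i → opposite i ∈? p) (AllPairs.tabulate⁺-< {f = opposite} opposite-<)

fromSubset-toSubset : ∀ {c : List (Fin n)} → Descending c → fromSubset (toSubset c) ≡ c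
fromSubset-toSubset {c = c} desc = AllPairs-unique (λ x>y y>x → <-asym x>y y>x)
  (fromSubset-descending (toSubset c)) desc
  (λ {i} i∈ → subst (_∈ c) (opposite-involutive i) (∈-toSubset⁻ (∈-fromSubset⁻ i∈)))
  (λ i∈ → ∈-fromSubset⁺ (∈-toSubset⁺′ i∈))

-- Set partitions and descending forms.

-- The meeting point of two bijections: these lists are the cycle forms of the avoiders, and also
-- the reversed lists of reflected blocks of set partitions.
record IsDescendingForm (cs : List (List (Fin n))) : Set where
  field
    descending : All Descending cs
    ordered    : AllPairs _≺_ ([] ∷ cs)
    distinct   : Unique (concat cs)
    complete   : ∀ i → i ∈ concat cs

open IsDescendingForm

setPartition⇒descendingForm : ∀ {ps : List (Subset n)} → ps ∈ setPartitions n →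
                              IsDescendingForm (reverse (map fromSubset ps))
setPartition⇒descendingForm {n} {ps} ps∈
  with ∈-filter⁻ isSetPartition? {xs = subsequences (subsets n)} ps∈
... | ps∈′ , nonempty , disjoint , cover = record
  { descending = All.tabulate desc
  ; ordered    = All.tabulate (nonempty-≺ ∘ ∈-reverse-map⁻) ∷
                 AllPairs-reverse⁺ (AllPairs.map⁺ (AllPairs.zipWith precedes
                   (disjoint , AllPairs-subsequences (subsets-⊏ n) ps∈′)))
  ; distinct   = AllPairs.concat⁺ (All.tabulate (AllPairs.map (λ y<x → <⇒≢ y<x ∘ sym) ∘ desc))
                 (AllPairs-reverse⁺ (AllPairs.map⁺ (AllPairs.map separate disjoint)))
  ; complete   = λ i → ∈-concat⁺ (Any.reverse⁺ (Any.map⁺ (Any.map ∈-fromSubset⁺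
                   (∈-⋃⁻ ps (subst (opposite i ∈ₛ_) (sym cover) ∈⊤)))))
  }
  where
  ∈-reverse-map⁻ : ∀ {c} → c ∈ reverse (map fromSubset ps) → ∃ λ p → p ∈ ps × c ≡ fromSubset p
  ∈-reverse-map⁻ = ∈-map⁻ fromSubset ∘ Any.reverse⁻

  desc : ∀ {c} → c ∈ reverse (map fromSubset ps) → Descending c
  desc c∈ with p , _ , refl ← ∈-reverse-map⁻ c∈ = fromSubset-descending p

  nonempty-≺ : ∀ {c} → (∃ λ p → p ∈ ps × c ≡ fromSubset p) → [] ≺ c
  nonempty-≺ (p , p∈ , refl) = Any.map (λ _ → []) (∈-fromSubset⁺′ (proj₂ (All.lookup nonempty p∈)))

  -- The reflection of an `i` in `p` below all of `q` lies above the whole reflected `q`. The order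
  -- of blocks is thus inverted, which `reverse` undoes.
  precedes : ∀ {p q} → Empty (p ∩ q) × p ⊏ q → fromSubset q ≺ fromSubset p
  precedes (disj , p⊏q) with i , i∈p , i<q ← ⊏⇒min< disj p⊏q =
    Any.map (λ { refl → All.tabulate λ x∈ → opposite-<-swapˡ (i<q (∈-fromSubset⁻ x∈)) })
      (∈-fromSubset⁺′ i∈p)

  separate : ∀ {p q : Subset n} → Empty (p ∩ q) → Disjoint (fromSubset q) (fromSubset p)
  separate disj = All.tabulate λ x∈ → All.tabulate λ { y∈ refl →
    disj (_ , x∈p∩q⁺ (∈-fromSubset⁻ y∈ , ∈-fromSubset⁻ x∈)) }

descendingForm⇒setPartition : ∀ {cs : List (List (Fin n))} → IsDescendingForm cs →
  ∃ λ ps → ps ∈ setPartitions n × cs ≡ reverse (map fromSubset ps)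
descendingForm⇒setPartition {n} {cs} form =
  ps , ∈-filter⁺ isSetPartition? ps∈ (nonempty , disjoint , cover) , sym restore
  where
  ps = reverse (map toSubset cs)

  precedes : ∀ {c d} → c ≺ d → toSubset d ⊏ toSubset c
  precedes c≺d with y , y∈d , c<y ← find c≺d =
    min<⇒⊏ (∈-toSubset⁺′ y∈d) (λ j∈ → opposite-<-swapʳ (All.lookup c<y (∈-toSubset⁻ j∈)))

  -- Sets of blocks are represented only in the order of `subsets n`, so `ps` must be shown sorted
  -- by `⊏`.
  ps∈ : ps ∈ subsequences (subsets n)
  ps∈ = ∈-subsequences⁺ ⊏-asym (subsets-⊏ n)
    (AllPairs-reverse⁺ (AllPairs.map⁺ (AllPairs.map precedes (AllPairs.tail (ordered form)))))
    (λ {p} _ → ∈-subsets p)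

  nonempty : All Nonempty ps
  nonempty = All.tabulate λ p∈ → nonempty′ (∈-map⁻ toSubset (Any.reverse⁻ p∈))
    where
    nonempty′ : ∀ {p} → (∃ λ c → c ∈ cs × p ≡ toSubset c) → Nonempty p
    nonempty′ (c , c∈ , refl) 
      with y , y∈c , _ ← find (All.lookup (AllPairs.head (ordered form)) c∈) =
      opposite y , ∈-toSubset⁺′ y∈c

  disjoint : AllPairs (λ p q → Empty (p ∩ q)) ps
  disjoint = AllPairs-reverse⁺ (AllPairs.map⁺ (AllPairs.map separate
    (proj₂ (AllPairs-concat⁻ cs (distinct form)))))
    where
    separate : ∀ {c d : List (Fin n)} → Disjoint c d → Empty (toSubset d ∩ toSubset c)
    separate {c} {d} disj (i , i∈) with i∈d , i∈c ← x∈p∩q⁻ (toSubset d) (toSubset c) i∈ =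
      All.lookup (All.lookup disj (∈-toSubset⁻ i∈c)) (∈-toSubset⁻ i∈d) refl

  cover : ⋃ ps ≡ ⊤
  cover = ⊆-antisym (λ _ → ∈⊤) λ {i} _ → ∈-⋃⁺ (Any.reverse⁺ (Any.map⁺
    (Any.map ∈-toSubset⁺ (∈-concat⁻ cs (complete form (opposite i))))))

  restore : reverse (map fromSubset ps) ≡ cs
  restore = begin
    reverse (map fromSubset (reverse (map toSubset cs)))
      ≡⟨ cong reverse (reverse-map fromSubset (map toSubset cs)) ⟩
    reverse (reverse (map fromSubset (map toSubset cs)))
      ≡⟨ reverse-involutive _ ⟩
    map fromSubset (map toSubset cs)
      ≡⟨ map-∘ cs ⟨
    map (fromSubset ∘ toSubset) cs
      ≡⟨ map-id-local (All.map fromSubset-toSubset (descending form)) ⟩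
    cs ∎
    where open ≡-Reasoning

-- Avoiding words and descending forms.

-- A missing `i` put in front of `xs` would give `n + 1` distinct elements of `Fin n`.
unique⇒complete : ∀ {xs : List (Fin n)} → Unique xs → length xs ≡ n → ∀ i → i ∈ xs
unique⇒complete {n} {xs} xs! len i = decidable-stable (i ∈ₗ? xs) λ i∉ →
  1+n≰n (subst₂ ℕ._≤_ (cong suc len) (length-tabulate {n = n} id)
    (length-≤ _≡_ (All.tabulate (λ { y∈ refl → i∉ y∈ }) ∷ xs!)
      (λ {x} _ → x , ∈-allFin x , refl) (λ { _ _ refl refl → refl })))

unique∧complete⇒length : ∀ {xs : List (Fin n)} → Unique xs → (∀ i → i ∈ xs) → length xs ≡ n
unique∧complete⇒length {n} xs! xs∋ = trans
  (length-≡ _≡_ xs! (Unique.allFin⁺ n)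
    (λ {x} _ → x , ∈-allFin x , refl) (λ {x} _ → x , xs∋ x , refl)
    (λ { _ _ refl refl → refl }) (λ { _ _ refl refl → refl }))
  (length-tabulate {n = n} id)

∈-𝒮⟨⟩⁺ : ∀ {k} (τ : ArrowPattern k) {π : Word n} →
         Unique (toList π) → Avoids τ π → π ∈ 𝒮⟨ τ ⟩ n
∈-𝒮⟨⟩⁺ τ {π} π! avoids = ∈-filter⁺ (avoids? τ)
  (∈-filter⁺ unique? (∈-vectors ∈-allFin π) (toList-AllPairs⁻ π!)) avoids

∈-𝒮⟨⟩⁻ : ∀ {k} (τ : ArrowPattern k) {π : Word n} →
         π ∈ 𝒮⟨ τ ⟩ n → Unique (toList π) × Avoids τ π
∈-𝒮⟨⟩⁻ {n} τ π∈ with π∈𝒮 , avoids ← ∈-filter⁻ (avoids? τ) {xs = 𝒮 n} π∈ =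
  toList-AllPairs⁺ (proj₂ (∈-filter⁻ unique? {xs = vectors (allFin n) n} π∈𝒮)) , avoids

-- By `parenthesise-headMax`, an entry of the first component would be bounded by a member of the
-- empty `left`.
parenthesise-[] : (xs : List (Fin n)) → proj₁ (parenthesise [] xs) ≡ []
parenthesise-[] xs with proj₁ (parenthesise [] xs) | proj₁ (parenthesise-headMax [] xs)
... | []    | _      = refl
... | _ ∷ _ | () ∷ _

concat-cycleForm : (π : Word n) → concat (cycleForm π) ≡ toList π
concat-cycleForm π = trans (cong (_++ concat (cycleForm π)) (sym (parenthesise-[] (toList π))))
                           (concat-parenthesise [] (toList π))

-- Erasing the parentheses recovers the word.
cycleForm-injective : {π ρ : Word n} → cycleForm π ≡ cycleForm ρ → π ≡ ρ
cycleForm-injective {π = π} {ρ} eq = trans (sym (Vec.cast-is-id refl π))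
  (Vec.toList-injective refl π ρ
    (trans (sym (concat-cycleForm π)) (trans (cong concat eq) (concat-cycleForm ρ))))

avoider⇒descendingForm : ∀ {π : Word n} → π ∈ 𝒮⟨ ⟨31∶1→2⟩ ⟩ n → IsDescendingForm (cycleForm π)
avoider⇒descendingForm {n} {π} π∈ with π! , avoids ← ∈-𝒮⟨⟩⁻ ⟨31∶1→2⟩ π∈ = record
  { descending = avoidsArrow⇒descending (proj₂ (parenthesise-headMax [] (toList π))) distinct′
                   (subst (hat π AvoidsArrow_) (sym eq) (avoids⇒avoidsArrow π avoids))
  ; ordered    = subst (λ c → AllPairs _≺_ ((c ++ []) ∷ cycleForm π)) (parenthesise-[] (toList π))
                   (parenthesise-≺ [] (toList π))
  ; distinct   = distinct′
  ; complete   = λ i → subst (i ∈_) (sym eq) (unique⇒complete π! (Vec.length-toList π) i)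
  }
  where
  eq = concat-cycleForm π
  distinct′ : Unique (concat (cycleForm π))
  distinct′ = subst Unique (sym eq) π!

toList-surjective : (xs : List A) → length xs ≡ n → ∃ λ (v : Vec A n) → toList v ≡ xs
toList-surjective xs refl = Vec.fromList xs , Vec.toList∘fromList xs

descendingForm⇒avoider : ∀ {cs : List (List (Fin n))} → IsDescendingForm cs →
                         ∃ λ π → π ∈ 𝒮⟨ ⟨31∶1→2⟩ ⟩ n × cycleForm π ≡ cs
descendingForm⇒avoider {n} {cs} form
  with π , eq ← toList-surjective (concat cs) (unique∧complete⇒length (distinct form) (complete form)) =
  π ,
  ∈-𝒮⟨⟩⁺ ⟨31∶1→2⟩ (subst Unique (sym eq) (distinct form)) (avoidsArrow⇒avoids π avoidsArrow) ,
  form-eq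
  where
  form-eq : cycleForm π ≡ cs
  form-eq = cong proj₂ (trans (cong (parenthesise []) eq)
    (parenthesise-concat [] (descending form) (ordered form)))

  avoidsArrow : hat π AvoidsArrow toList π
  avoidsArrow = subst₂ (λ ds xs → cycles ds AvoidsArrow xs) (sym form-eq) (sym eq)
    (descending⇒avoidsArrow (AllPairs.tail (ordered form))
      (proj₂ (AllPairs-concat⁻ cs (distinct form))) (descending form))

theorem4p1 : ∀ (n : ℕ) → n ≥ 1 → length (𝒮⟨ ⟨31∶1→2⟩ ⟩ n) ≡ Bell n
-- A word and a partition correspond when they yield the same descending form. Both maps to
-- descending forms are injective and onto, which gives the four conditions.
theorem4p1 n _ = length-≡ (λ π ps → cycleForm π ≡ reverse (map fromSubset ps))
  (Unique.filter⁺ _ (Unique.filter⁺ unique? (vectors-unique (Unique.allFin⁺ n) n)))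
  (Unique.filter⁺ isSetPartition? (subsequences-unique (subsets-unique n)))
  (descendingForm⇒setPartition ∘ avoider⇒descendingForm)
  (descendingForm⇒avoider ∘ setPartition⇒descendingForm)
  (λ _ _ eq eq′ → cycleForm-injective (trans eq (sym eq′)))
  (λ _ _ eq eq′ → map-injective fromSubset-injective (reverse-injective (trans (sym eq) eq′)))
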